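{- The exponential generating function $f(x,y)=f(x,y;p,q)=\sum_{n\ge1}a_n(y;p,q)\frac{x^n}{n!}$ satisfies $$\frac{\partial}{\partial x}f(x,y)=ypq^2+\frac{ypq}{1-yp}\bigl(f(x,1)-f(x,yp)\bigr)+\frac{ypq^2}{1-ypq}\bigl(f(x,yp)-ypq\,f(xypq,1/q)\bigr).$$
   Context: An inversion sequence of length $n$ is a sequence $\rho=\rho_1\cdots\rho_n$ of integers with $1\le \rho_i\le i$ for all $i$. Let $I_{n,i}$ be the set of inversion sequences of length $n$ with last letter $i$. Represent $\rho$ as a bargraph whose $i$-th column has $\rho_i$ unit cells. Let $\mathrm{area}(\rho)=\rho_1+\cdots+\rho_n$ and let $\mathrm{sper}(\rho)$ be half the perimeter of the bargraph (bottom boundary included), i.e. $\mathrm{sper}(\rho)=n+\rho_1+\sum_{i=1}^{n-1}\max(\rho_{i+1}-\rho_i,0)$. Define $a_{n,i}(p,q)=\sum_{\rho\in I_{n,i}}p^{\mathrm{area}(\rho)}q^{\mathrm{sper}(\rho)}$ and $a_n(y;p,q)=\sum_{i=1}^n a_{n,i}(p,q)y^i$. -}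

module Defs where

open import Algebra.Bundles using (CommutativeRing)
import Algebra.Definitions
import Algebra.Properties.Monoid.Sum as MonoidSum
import Algebra.Properties.Semiring.Exp as SemiringExp
import Algebra.Properties.Semiring.Mult as SemiringMult
open import Data.Fin.Base using (Fin; zero; suc; toℕ; inject₁)
open import Data.List.Base as List using (List; foldr; map; filter; applyUpTo; cartesianProductWith)
open import Data.List.Membership.Propositional using (_∈_)
open import Data.List.Membership.Propositional.Properties using (∈-applyUpTo⁺; ∈-applyUpTo⁻; ∈-cartesianProductWith⁺; ∈-cartesianProductWith⁻; ∈-filter⁺; ∈-filter⁻)
open import Data.List.Relation.Unary.All as All using ()
open import Data.List.Relation.Unary.AllPairs as AllPairs using ()
open import Data.List.Relation.Unary.Any using (here)
open import Data.List.Relation.Unary.Unique.Propositional using (Unique)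
import Data.List.Relation.Unary.Unique.Propositional.Properties as Unique
open import Data.Nat.Base as ℕ using (ℕ; zero; suc; _∸_; _!; _≤_; z≤n; s≤s)
open import Data.Nat.Properties using (_≟_; <⇒≢; suc-injective)
open import Data.Product.Base using (_,_) renaming (_×_ to _∧_)
open import Data.Vec.Base as Vec using (Vec; []; _∷_; _∷ʳ_; lookup; head; last; initLast; tabulate)
open import Data.Vec.Properties using (∷ʳ-injective)
open import Function.Base using (_∘_)
open import Function.Bundles using (_⇔_; mk⇔)
open import Level using (_⊔_)
open import Relation.Binary.PropositionalEquality.Core using (_≡_; refl)

-- Positions are counted from 0 by Fin, so the i-th letter of the usual
-- 1-based indexing sits at toℕ k = i - 1.
IsInversionSequence : ∀ {n} → Vec ℕ n → Set
IsInversionSequence {n} ρ = (k : Fin n) → 1 ≤ lookup ρ k ∧ lookup ρ k ≤ suc (toℕ k)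

-- Every inversion sequence of length n, listed exactly once (see
-- ∈-inversionSequences and inversionSequences-unique); applyUpTo suc (suc n)
-- is the list 1, …, n + 1.
inversionSequences : (n : ℕ) → List (Vec ℕ n)
inversionSequences zero    = List.[ [] ]
inversionSequences (suc n) =
  cartesianProductWith _∷ʳ_ (inversionSequences n) (applyUpTo suc (suc n))

I[1+_][_] : (m i : ℕ) → List (Vec ℕ (suc m))
I[1+ m ][ i ] = filter (λ ρ → last ρ ≟ i) (inversionSequences (suc m))

area : ∀ {n} → Vec ℕ n → ℕ
area = Vec.sum

-- n + ρ₁ + Σ_{i=1}^{n-1} max(ρ_{i+1} - ρ_i, 0), with n = suc m.
sper : ∀ {m} → Vec ℕ (suc m) → ℕ
sper {m} ρ =
  suc m ℕ.+ head ρ ℕ.+ Vec.sum (tabulate λ (k : Fin m) → lookup ρ (suc k) ∸ lookup ρ (inject₁ k))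

private
  snoc⁺ : (Q : ℕ → ℕ → Set) → ∀ {n} (ρ : Vec ℕ n) {r} →
          (∀ k → Q (toℕ k) (lookup ρ k)) → Q n r → ∀ k → Q (toℕ k) (lookup (ρ ∷ʳ r) k)
  snoc⁺ Q []      h q zero    = q
  snoc⁺ Q (x ∷ ρ) h q zero    = h zero
  snoc⁺ Q (x ∷ ρ) h q (suc k) = snoc⁺ (Q ∘ suc) ρ (h ∘ suc) q k

  snoc⁻ : (Q : ℕ → ℕ → Set) → ∀ {n} (ρ : Vec ℕ n) {r} →
          (∀ k → Q (toℕ k) (lookup (ρ ∷ʳ r) k)) → (∀ k → Q (toℕ k) (lookup ρ k)) ∧ Q n r
  snoc⁻ Q []      h = (λ ()) , h zero
  snoc⁻ Q (x ∷ ρ) h with h′ , q ← snoc⁻ (Q ∘ suc) ρ (h ∘ suc) =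
    (λ { zero → h zero ; (suc k) → h′ k }) , q

  Bounds : ℕ → ℕ → Set
  Bounds k r = 1 ≤ r ∧ r ≤ suc k

  sound : ∀ n {ρ : Vec ℕ n} → ρ ∈ inversionSequences n → IsInversionSequence ρ
  sound zero    _  ()
  sound (suc n) ρ∈
    with σ , r , σ∈ , r∈ , refl ← ∈-cartesianProductWith⁻ _∷ʳ_ (inversionSequences n) (applyUpTo suc (suc n)) ρ∈
    with _ , j<1+n , refl ← ∈-applyUpTo⁻ suc r∈
    = snoc⁺ Bounds σ (sound n σ∈) (s≤s z≤n , j<1+n)

  complete : ∀ n (ρ : Vec ℕ n) → IsInversionSequence ρ → ρ ∈ inversionSequences n
  complete zero    [] _ = here refl
  complete (suc n) ρ  h with initLast ρ
  ... | σ , r , refl with snoc⁻ Bounds σ h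
  ... | h′ , s≤s z≤n , r≤ = ∈-cartesianProductWith⁺ _∷ʳ_ (complete n σ h′) (∈-applyUpTo⁺ suc r≤)

∈-inversionSequences : ∀ n (ρ : Vec ℕ n) → ρ ∈ inversionSequences n ⇔ IsInversionSequence ρ
∈-inversionSequences n ρ = mk⇔ (sound n) (complete n ρ)

inversionSequences-unique : ∀ n → Unique (inversionSequences n)
inversionSequences-unique zero    = All.[] AllPairs.∷ AllPairs.[]
inversionSequences-unique (suc n) =
  Unique.cartesianProductWith⁺ _∷ʳ_ (∷ʳ-injective _ _) (inversionSequences-unique n)
    (Unique.applyUpTo⁺₁ suc (suc n) (λ i<j _ → <⇒≢ i<j ∘ suc-injective))

∈-I : ∀ m i (ρ : Vec ℕ (suc m)) → ρ ∈ I[1+ m ][ i ] ⇔ (IsInversionSequence ρ ∧ last ρ ≡ i)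
∈-I m i ρ = mk⇔
  (λ ρ∈ → let ρ∈all , eq = ∈-filter⁻ (λ ρ → last ρ ≟ i) ρ∈ in sound (suc m) ρ∈all , eq)
  (λ (h , eq) → ∈-filter⁺ (λ ρ → last ρ ≟ i) (complete (suc m) ρ h) eq)

I-unique : ∀ m i → Unique I[1+ m ][ i ]
I-unique m i = Unique.filter⁺ (λ ρ → last ρ ≟ i) (inversionSequences-unique (suc m))

module GeneratingFunction {c ℓ} (R : CommutativeRing c ℓ) where
  open CommutativeRing R
  open Algebra.Definitions _≈_ using (Invertible)
  open MonoidSum +-monoid public using (sum-syntax)
  open SemiringExp semiring public using (_^_)
  open SemiringMult semiring public using (_×_)

  Unit : Carrier → Set (c ⊔ ℓ)
  Unit = Invertible 1# _*_

  infixl 7 _/_[_]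

  _/_[_] : Carrier → (d : Carrier) → Unit d → Carrier
  a / d [ d⁻¹ , _ ] = a * d⁻¹

  -- Formal power series in x; g n is the coefficient of xⁿ.
  Series : Set c
  Series = ℕ → Carrier

  infix  4 _≋_
  infixl 6 _⊕_ _⊖_
  infixr 7 _·_

  _≋_ : Series → Series → Set ℓ
  g ≋ h = ∀ n → g n ≈ h n

  _⊕_ _⊖_ : Series → Series → Series
  (g ⊕ h) n = g n + h n
  (g ⊖ h) n = g n - h n

  const : Carrier → Series
  const a zero    = a
  const a (suc _) = 0#

  _·_ : Carrier → Series → Series
  (a · g) n = a * g n

  ∂ₓ : Series → Series
  ∂ₓ g n = suc n × g (suc n)

  -- g(x) ↦ g(x t)
  _⟨x*_⟩ : Series → Carrier → Series
  (g ⟨x* t ⟩) n = g n * t ^ n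

  module _ (p q : Carrier) where

    a[1+_][_] : (m i : ℕ) → Carrier
    a[1+ m ][ i ] = foldr _+_ 0# (map (λ ρ → p ^ area ρ * q ^ sper ρ) I[1+ m ][ i ])

    -- The summation index i runs over 1, …, n = suc m, shifted to start at 0.
    a[1+_] : (m : ℕ) → Carrier → Carrier
    a[1+ m ] y = ∑[ j < suc m ] (a[1+ m ][ suc (toℕ j) ] * y ^ suc (toℕ j))

    f : (∀ n → Unit ((n !) × 1#)) → Carrier → Series
    f n!-unit y zero    = 0#
    f n!-unit y (suc m) = a[1+ m ] y / ((suc m !) × 1#) [ n!-unit (suc m) ]

{-# OPTIONS --safe #-}
module Submission where

-- Appending a letter r to an inversion sequence ρ of length n with last letter l
-- adds r to the area and 1 + max(r - l, 0) to the semiperimeter.  Hence, with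
-- z = y p, a_{n+1}(y) is the sum over ρ of the weight of ρ times
--   q ∑_{r ≤ n+1} z^r q^{max(r - l, 0)},
-- and splitting this sum at r = l leaves two geometric sums:
--   z q (1 - z^l) / (1 - z) + z q² (z^l - z q (z q)^n q^{-l}) / (1 - z q).
-- The powers 1^l, z^l and q^{-l} turn the sum over ρ into a_n(1), a_n(yp) and
-- a_n(1/q); the derivative cancels the factor n + 1 of the factorial.

open import Defs
open import Algebra.Bundles using (CommutativeRing)
import Algebra.Properties.CommutativeMonoid.Sum as CommutativeMonoidSum
import Algebra.Properties.CommutativeSemiring.Exp as CommutativeSemiringExp
import Algebra.Properties.Ring as RingProperties
import Algebra.Properties.Semiring.Exp as SemiringExp
import Algebra.Properties.Semiring.Mult as SemiringMult
import Algebra.Properties.Semiring.Mult.TCOptimised as SemiringMultTCOptimised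
import Algebra.Solver.Ring as RingSolver
open import Algebra.Solver.Ring.AlmostCommutativeRing using (fromCommutativeRing; _-Raw-AlmostCommutative⟶_)
open import Data.Bool.Base using (true; false; if_then_else_)
open import Data.Fin.Base using (toℕ; fromℕ; inject₁; suc)
open import Data.Fin.Properties using (toℕ-fromℕ)
open import Data.Integer.Base as ℤ using (ℤ; +_; -[1+_])
import Data.Integer.Properties as ℤ
open import Data.List.Base using (List; []; _∷_; _++_; map; foldr; filter; applyUpTo; cartesianProductWith)
open import Data.List.Membership.Propositional using (_∈_)
open import Data.List.Relation.Unary.Any using (here; there)
open import Data.Maybe.Base using () renaming (map to map-maybe)
open import Data.Nat.Base as ℕ using (ℕ; zero; suc; _∸_; _!; _≤_; _<_; s≤s)
import Data.Nat.Properties as ℕ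
open import Data.Product.Base using (_,_; proj₁; proj₂) renaming (_×_ to _∧_)
open import Data.Vec.Base as Vec using (Vec; []; _∷_; _∷ʳ_; last; lookup; head; tabulate)
open import Data.Vec.Properties using (last-∷ʳ)
open import Function.Base using (_∘_)
open import Function.Bundles using (Equivalence)
open import Level using (Level)
open import Relation.Binary.Consequences using (dec⇒weaklyDec)
open import Relation.Binary.PropositionalEquality.Core as ≡ using (_≡_; cong; cong₂)
import Relation.Binary.Reasoning.Setoid as SetoidReasoning
open import Relation.Nullary.Decidable.Core using (does)

-- Statistics of a sequence after appending a letter.

last≡lookup-fromℕ : ∀ {m} (ρ : Vec ℕ (suc m)) → last ρ ≡ lookup ρ (fromℕ m)
last≡lookup-fromℕ (x ∷ [])    = ≡.refl
last≡lookup-fromℕ (x ∷ y ∷ ρ) = last≡lookup-fromℕ (y ∷ ρ)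

-- The lower bound places every sequence in one of the fibres i = 1, ..., n of the last letter. The
-- upper bound keeps the splitting point l within the range of the appended letter.
last-bounds : ∀ m {ρ : Vec ℕ (suc m)} → ρ ∈ inversionSequences (suc m) → 1 ≤ last ρ ∧ last ρ ≤ suc m
last-bounds m {ρ} ρ∈ rewrite last≡lookup-fromℕ ρ
  with 1≤l , l≤ ← Equivalence.to (∈-inversionSequences (suc m) ρ) ρ∈ (fromℕ m)
  rewrite toℕ-fromℕ m = 1≤l , l≤

area-∷ʳ : ∀ {n} (ρ : Vec ℕ n) r → area (ρ ∷ʳ r) ≡ area ρ ℕ.+ r
area-∷ʳ []      r = ℕ.+-identityʳ r
area-∷ʳ (x ∷ ρ) r = ≡.trans (cong (x ℕ.+_) (area-∷ʳ ρ r)) (≡.sym (ℕ.+-assoc x (area ρ) r))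

-- Isolated from `sper` because it unfolds along `_∷_` with no `head` term, which is what the
-- induction in `rises-∷ʳ` relies on.
rises : ∀ {m} → Vec ℕ (suc m) → ℕ
rises {m} ρ = Vec.sum (tabulate {n = m} λ k → lookup ρ (suc k) ∸ lookup ρ (inject₁ k))

rises-∷ʳ : ∀ {m} (ρ : Vec ℕ (suc m)) r → rises (ρ ∷ʳ r) ≡ rises ρ ℕ.+ (r ∸ last ρ)
rises-∷ʳ (x ∷ [])    r = ℕ.+-identityʳ (r ∸ x)
rises-∷ʳ (x ∷ y ∷ ρ) r =
  ≡.trans (cong (y ∸ x ℕ.+_) (rises-∷ʳ (y ∷ ρ) r)) (≡.sym (ℕ.+-assoc (y ∸ x) (rises (y ∷ ρ)) _))

head-∷ʳ : ∀ {m} (ρ : Vec ℕ (suc m)) r → head (ρ ∷ʳ r) ≡ head ρ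
head-∷ʳ (x ∷ ρ) r = ≡.refl

sper-∷ʳ : ∀ {m} (ρ : Vec ℕ (suc m)) r → sper (ρ ∷ʳ r) ≡ suc (sper ρ ℕ.+ (r ∸ last ρ))
sper-∷ʳ {m} ρ r = ≡.trans
  (cong₂ (λ h s → suc (suc m) ℕ.+ h ℕ.+ s) (head-∷ʳ ρ r) (rises-∷ʳ ρ r))
  (≡.sym (ℕ.+-assoc (suc (suc m) ℕ.+ head ρ) (rises ρ) (r ∸ last ρ)))

-- The integers as solver coefficients.

-- With coefficients from R, whose equality is not decidable, the ring solver cannot
-- cancel terms; with integer coefficients it can.
module IntegerCoefficients {c ℓ} (R : CommutativeRing c ℓ) where
  open CommutativeRing R hiding (zero)
  open RingProperties ring
  open SemiringMultTCOptimised semiring using (_×_; ×-homo-+; ×1-homo-*; 1+×)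
  open SetoidReasoning setoid

  -- With the optimised `_×_`, `fromℤ (+ 1)` reduces to `1#` rather than `1# + 0#`, so `con (+ 1)`
  -- matches a literal `1#` in the goals.
  fromℤ : ℤ → Carrier
  fromℤ (+ n)    = n × 1#
  fromℤ -[1+ n ] = - (suc n × 1#)

  -- Lowering both arguments by one changes neither side, so the induction ends when one is zero.
  -- Sums of mixed sign reduce to this.
  fromℤ-⊖ : ∀ m n → fromℤ (m ℤ.⊖ n) ≈ m × 1# - n × 1#
  fromℤ-⊖ m       zero    = sym (trans (+-congˡ -0#≈0#) (+-identityʳ _))
  fromℤ-⊖ zero    (suc n) = sym (+-identityˡ _)
  fromℤ-⊖ (suc m) (suc n) = begin
    fromℤ (suc m ℤ.⊖ suc n)                   ≡⟨ cong fromℤ (ℤ.[1+m]⊖[1+n]≡m⊖n m n) ⟩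
    fromℤ (m ℤ.⊖ n)                           ≈⟨ fromℤ-⊖ m n ⟩
    m × 1# - n × 1#                         ≈⟨ +-congʳ (xyx⁻¹≈y 1# (m × 1#)) ⟨
    1# + m × 1# - 1# - n × 1#               ≈⟨ +-assoc _ _ _ ⟩
    1# + m × 1# + (- 1# - n × 1#)           ≈⟨ +-congˡ (-‿+-comm 1# (n × 1#)) ⟩
    1# + m × 1# - (1# + n × 1#)             ≈⟨ +-cong (1+× m 1#) (-‿cong (1+× n 1#)) ⟨
    suc m × 1# - suc n × 1# ∎

  fromℤ-+ : ∀ i j → fromℤ (i ℤ.+ j) ≈ fromℤ i + fromℤ j
  fromℤ-+ (+ m)    (+ n)    = ×-homo-+ 1# m n
  fromℤ-+ (+ m)    -[1+ n ] = fromℤ-⊖ m (suc n)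
  fromℤ-+ -[1+ m ] (+ n)    = trans (fromℤ-⊖ n (suc m)) (+-comm _ _)
  fromℤ-+ -[1+ m ] -[1+ n ] = begin
    - (suc (suc (m ℕ.+ n)) × 1#)    ≡⟨ cong (λ k → - (suc k × 1#)) (ℕ.+-suc m n) ⟨
    - ((suc m ℕ.+ suc n) × 1#)      ≈⟨ -‿cong (×-homo-+ 1# (suc m) (suc n)) ⟩
    - (suc m × 1# + suc n × 1#)     ≈⟨ -‿+-comm _ _ ⟨
    - (suc m × 1#) - suc n × 1# ∎

  fromℤ-neg : ∀ i → fromℤ (ℤ.- i) ≈ - fromℤ i
  fromℤ-neg (+ zero)  = sym -0#≈0#
  fromℤ-neg (+ suc n) = refl
  fromℤ-neg -[1+ n ]  = sym (-‿involutive _)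

  -- Settles the sign of the right factor, leaving only that of the left one to `fromℤ-*`.
  fromℤ-+* : ∀ m j → fromℤ (+ m ℤ.* j) ≈ m × 1# * fromℤ j
  fromℤ-+* m (+ n) = trans (reflexive (cong fromℤ (≡.sym (ℤ.pos-* m n)))) (×1-homo-* m n)
  fromℤ-+* m -[1+ n ] = begin
    fromℤ (+ m ℤ.* ℤ.- + suc n)        ≡⟨ cong fromℤ (ℤ.neg-distribʳ-* (+ m) (+ suc n)) ⟨
    fromℤ (ℤ.- (+ m ℤ.* + suc n))      ≈⟨ fromℤ-neg (+ m ℤ.* + suc n) ⟩
    - fromℤ (+ m ℤ.* + suc n)          ≈⟨ -‿cong (fromℤ-+* m (+ suc n)) ⟩
    - (m × 1# * (suc n × 1#))          ≈⟨ -‿distribʳ-* _ _ ⟩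
    m × 1# * - (suc n × 1#) ∎

  fromℤ-* : ∀ i j → fromℤ (i ℤ.* j) ≈ fromℤ i * fromℤ j
  fromℤ-* (+ m)    j = fromℤ-+* m j
  fromℤ-* -[1+ m ] j = begin
    fromℤ (ℤ.- + suc m ℤ.* j)          ≡⟨ cong fromℤ (ℤ.neg-distribˡ-* (+ suc m) j) ⟨
    fromℤ (ℤ.- (+ suc m ℤ.* j))        ≈⟨ fromℤ-neg (+ suc m ℤ.* j) ⟩
    - fromℤ (+ suc m ℤ.* j)            ≈⟨ -‿cong (fromℤ-+* (suc m) j) ⟩
    - (suc m × 1# * fromℤ j)           ≈⟨ -‿distribˡ-* _ _ ⟩
    - (suc m × 1#) * fromℤ j ∎

  morphism : ℤ.+-*-rawRing -Raw-AlmostCommutative⟶ fromCommutativeRing R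
  morphism = record
    { ⟦_⟧    = fromℤ
    ; +-homo = fromℤ-+
    ; *-homo = fromℤ-*
    ; -‿homo = fromℤ-neg
    ; 0-homo = refl
    ; 1-homo = refl
    }

  open RingSolver ℤ.+-*-rawRing (fromCommutativeRing R) morphism
    (λ i j → map-maybe (λ eq → reflexive (cong fromℤ eq)) (dec⇒weaklyDec ℤ._≟_ i j)) public

private variable
  α β γ : Level
  A : Set α
  B : Set β
  C : Set γ

module _ {c ℓ} (R : CommutativeRing c ℓ) where
  open CommutativeRing R hiding (zero)
  open GeneratingFunction R
  open CommutativeMonoidSum +-commutativeMonoid using (sum-cong-≋; sum-replicate-zero; ∑-distrib-+)
  open CommutativeSemiringExp commutativeSemiring using (^-distrib-*)
  open SemiringExp semiring using (^-homo-*; ^-congˡ; ^-congʳ)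
  open SemiringMult semiring using (×-assoc-*; ×1-homo-*; ×-congʳ)
  open SetoidReasoning setoid

  open IntegerCoefficients R using (solve; con; _:=_; _:+_; _:*_; _:-_)

  -- Sums over lists and over fibres.

  sumOver : (A → Carrier) → List A → Carrier
  sumOver h xs = foldr _+_ 0# (map h xs)

  sumOver-cong : ∀ {g h : A → Carrier} xs → (∀ {x} → x ∈ xs → g x ≈ h x) → sumOver g xs ≈ sumOver h xs
  sumOver-cong []       g≈h = refl
  sumOver-cong (x ∷ xs) g≈h = +-cong (g≈h (here ≡.refl)) (sumOver-cong xs (g≈h ∘ there))

  sumOver-++ : ∀ (h : A → Carrier) xs ys → sumOver h (xs ++ ys) ≈ sumOver h xs + sumOver h ys
  sumOver-++ h []       ys = sym (+-identityˡ _)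
  sumOver-++ h (x ∷ xs) ys = trans (+-congˡ (sumOver-++ h xs ys)) (sym (+-assoc _ _ _))

  *-distribˡ-sumOver : ∀ c (h : A → Carrier) xs → c * sumOver h xs ≈ sumOver (λ x → c * h x) xs
  *-distribˡ-sumOver c h []       = zeroʳ c
  *-distribˡ-sumOver c h (x ∷ xs) = trans (distribˡ c _ _) (+-congˡ (*-distribˡ-sumOver c h xs))

  sumOver-map : ∀ (h : B → Carrier) (g : A → B) xs →
                sumOver h (map g xs) ≈ sumOver (h ∘ g) xs
  sumOver-map h g []       = refl
  sumOver-map h g (x ∷ xs) = +-congˡ (sumOver-map h g xs)

  sumOver-cartesianProductWith :
    ∀ (h : C → Carrier) (g : A → B → C) xs ys →
    sumOver h (cartesianProductWith g xs ys) ≈ sumOver (λ x → sumOver (h ∘ g x) ys) xs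
  sumOver-cartesianProductWith h g []       ys = refl
  sumOver-cartesianProductWith h g (x ∷ xs) ys = trans
    (sumOver-++ h (map (g x) ys) _)
    (+-cong (sumOver-map h (g x) ys) (sumOver-cartesianProductWith h g xs ys))

  sumOver-filter : ∀ (w : A → Carrier) (g : A → ℕ) i x xs →
    sumOver w (filter (λ x → g x ℕ.≟ i) (x ∷ xs)) ≈
    (if does (g x ℕ.≟ i) then w x else 0#) + sumOver w (filter (λ x → g x ℕ.≟ i) xs)
  sumOver-filter w g i x xs with does (g x ℕ.≟ i)
  ... | true  = refl
  ... | false = sym (+-identityˡ _)

  ∑-zero : ∀ n → ∑[ j < n ] 0# ≈ 0#
  ∑-zero = sum-replicate-zero

  ∑-indicator : ∀ n {k} (h : ℕ → Carrier) → k < n →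
    ∑[ j < n ] (if does (k ℕ.≟ toℕ j) then h (toℕ j) else 0#) ≈ h k
  ∑-indicator (suc n) {zero}  h _         = trans (+-congˡ (∑-zero n)) (+-identityʳ _)
  ∑-indicator (suc n) {suc k} h (s≤s k<n) = trans (+-identityˡ _) (∑-indicator n (h ∘ suc) k<n)

  -- Induction on the list: a new `x` joins exactly one fibre, that with `suc (toℕ j)` equal to
  -- `g x`, and the bounds ensure that this index occurs.
  sumOver-fibres : ∀ n (w : A → Carrier) (g : A → ℕ) (h : ℕ → Carrier) xs →
    (∀ {x} → x ∈ xs → 1 ≤ g x ∧ g x ≤ n) →
    ∑[ j < n ] (sumOver w (filter (λ x → g x ℕ.≟ suc (toℕ j)) xs) * h (suc (toℕ j))) ≈
    sumOver (λ x → w x * h (g x)) xs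
  sumOver-fibres n w g h [] bounds = trans (sum-cong-≋ {n} (λ j → zeroˡ _)) (∑-zero n)
  sumOver-fibres n w g h (x ∷ xs) bounds = begin
    ∑[ j < n ] (sumOver w (filter (λ x → g x ℕ.≟ suc (toℕ j)) (x ∷ xs)) * h (suc (toℕ j)))
      ≈⟨ sum-cong-≋ {n} (λ j → trans (*-congʳ (sumOver-filter w g (suc (toℕ j)) x xs)) (distribʳ _ _ _)) ⟩
    ∑[ j < n ] (δ (suc (toℕ j)) * h (suc (toℕ j)) + rest (suc (toℕ j)))
      ≈⟨ ∑-distrib-+ {n} _ _ ⟩
    ∑[ j < n ] (δ (suc (toℕ j)) * h (suc (toℕ j))) + ∑[ j < n ] rest (suc (toℕ j))
      ≈⟨ +-cong (fibre (bounds (here ≡.refl))) (sumOver-fibres n w g h xs (bounds ∘ there)) ⟩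
    w x * h (g x) + sumOver (λ x → w x * h (g x)) xs ∎
    where
    δ rest : ℕ → Carrier
    δ i = if does (g x ℕ.≟ i) then w x else 0#
    rest i = sumOver w (filter (λ x → g x ℕ.≟ i) xs) * h i

    if-*ʳ : ∀ b u v → (if b then u else 0#) * v ≈ (if b then u * v else 0#)
    if-*ʳ true  u v = refl
    if-*ʳ false u v = zeroˡ v

    fibre : 1 ≤ g x ∧ g x ≤ n → ∑[ j < n ] (δ (suc (toℕ j)) * h (suc (toℕ j))) ≈ w x * h (g x)
    fibre (1≤ , ≤n) with g x
    -- The lower bound makes `g x` a successor; comparing `suc k` with `suc (toℕ j)` then computes
    -- to comparing `k` with `toℕ j`, as in `∑-indicator`.
    fibre (s≤s _ , k<n) | suc k = trans
      (sum-cong-≋ {n} (λ j → if-*ʳ (does (suc k ℕ.≟ suc (toℕ j))) _ _))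
      (∑-indicator n (λ j → w x * h (suc j)) k<n)

  -- Geometric sums over the appended letter.

  one-^ : ∀ n → 1# ^ n ≈ 1#
  one-^ zero    = refl
  one-^ (suc n) = trans (*-identityˡ _) (one-^ n)

  sumOver-applyUpTo-*ˡ : ∀ c (g h : ℕ → Carrier) → (∀ j → g j ≈ c * h j) → ∀ (s : ℕ → ℕ) n →
                         sumOver g (applyUpTo s n) ≈ c * sumOver h (applyUpTo s n)
  sumOver-applyUpTo-*ˡ c g h g≈ s n = trans
    (sumOver-cong (applyUpTo s n) (λ {j} _ → g≈ j))
    (sym (*-distribˡ-sumOver c h (applyUpTo s n)))

  -- `s` is arbitrary because each unfolding of `applyUpTo` precomposes it with `suc`.
  sumOver-applyUpTo-suc : ∀ (h : ℕ → Carrier) (s : ℕ → ℕ) n →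
    sumOver h (applyUpTo (suc ∘ s) n) ≈ sumOver (h ∘ suc) (applyUpTo s n)
  sumOver-applyUpTo-suc h s zero    = refl
  sumOver-applyUpTo-suc h s (suc n) = +-congˡ (sumOver-applyUpTo-suc h (s ∘ suc) n)

  -- For `v = t ^ k` this is the induction step of t + ... + t^k = t (1 - t^k) / (1 - t). Once the
  -- lone `t` is written as `t * ((1# - t) * u)`, a polynomial identity remains.
  geometric-step : ∀ t u v → (1# - t) * u ≈ 1# → t + t * (t * u * (1# - v)) ≈ t * u * (1# - t * v)
  geometric-step t u v inv = begin
    t + t * (t * u * (1# - v))                   ≈⟨ +-congʳ (*-identityʳ t) ⟨
    t * 1# + t * (t * u * (1# - v))              ≈⟨ +-congʳ (*-congˡ inv) ⟨
    t * ((1# - t) * u) + t * (t * u * (1# - v))  ≈⟨ lem t u v ⟩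
    t * u * (1# - t * v) ∎
    where
    lem = solve 3 (λ t u v →
      t :* ((con (+ 1) :- t) :* u) :+ t :* (t :* u :* (con (+ 1) :- v)) :=
      t :* u :* (con (+ 1) :- t :* v)) refl

  module _ (z q : Carrier) where

    stepSum : ℕ → ℕ → Carrier
    stepSum l n = sumOver (λ r → z ^ r * q ^ (r ∸ l)) (applyUpTo suc n)

    -- The letter 1 contributes `z`. Lowering the other letters and `suc l` by one extracts a factor
    -- `z` from each term and preserves every difference.
    stepSum-suc : ∀ l n → stepSum (suc l) (suc n) ≈ z + z * stepSum l n
    stepSum-suc l n = +-cong
      (trans (*-cong (*-identityʳ z) (^-congʳ q (ℕ.0∸n≡0 l))) (*-identityʳ z))
      (trans (sumOver-applyUpTo-suc (λ r → z ^ r * q ^ (r ∸ suc l)) suc n)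
             (sumOver-applyUpTo-*ˡ z _ _ (λ j → *-assoc z _ _) suc n))

    stepSum-zero-suc : ∀ n → stepSum 0 (suc n) ≈ z * q + z * q * stepSum 0 n
    stepSum-zero-suc n = +-cong
      (*-cong (*-identityʳ z) (*-identityʳ q))
      (trans (sumOver-applyUpTo-suc (λ r → z ^ r * q ^ r) suc n)
             (sumOver-applyUpTo-*ˡ (z * q) _ _ (λ j → lem z q (z ^ j) (q ^ j)) suc n))
      where
      lem = solve 4 (λ z q s t → (z :* s) :* (q :* t) := z :* q :* (s :* t)) refl

    -- Writing z as (1/q)(zq) trades the exponent k for l + k. In `stepSum-eval` this is the length
    -- n, so l survives only in the power of 1/q.
    z^l*[zq]^k : ∀ (q-unit : Unit q) l k → z ^ l * (z * q) ^ k ≈ (1# / q [ q-unit ]) ^ l * (z * q) ^ (l ℕ.+ k)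
    z^l*[zq]^k q-unit l k = begin
      z ^ l * (z * q) ^ k                           ≈⟨ *-congʳ (^-congˡ l z≈) ⟩
      (q⁻¹ * (z * q)) ^ l * (z * q) ^ k             ≈⟨ *-congʳ (^-distrib-* q⁻¹ (z * q) l) ⟩
      q⁻¹ ^ l * (z * q) ^ l * (z * q) ^ k           ≈⟨ *-assoc _ _ _ ⟩
      q⁻¹ ^ l * ((z * q) ^ l * (z * q) ^ k)         ≈⟨ *-congˡ (^-homo-* (z * q) l k) ⟨
      q⁻¹ ^ l * (z * q) ^ (l ℕ.+ k) ∎
      where
      q⁻¹ = 1# / q [ q-unit ]

      lem = solve 3 (λ z q r → z :* (r :* q) := con (+ 1) :* r :* (z :* q)) refl

      z≈ : z ≈ q⁻¹ * (z * q)
      z≈ = begin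
        z                         ≈⟨ *-identityʳ z ⟨
        z * 1#                    ≈⟨ *-congˡ (proj₁ (proj₂ q-unit)) ⟨
        z * (proj₁ q-unit * q)    ≈⟨ lem z q _ ⟩
        q⁻¹ * (z * q) ∎

    module _ (1-z-unit : Unit (1# - z)) (1-zq-unit : Unit (1# - z * q)) where
      private
        d e : Carrier
        d = proj₁ 1-z-unit
        e = proj₁ 1-zq-unit

      -- Induction on `l` collects the geometric sum of ratio z over the letters up to l; at `l = 0`
      -- all remaining letters are rises, and induction on `k` sums them with ratio zq.
      stepSum-closed : ∀ l k →
        stepSum l (l ℕ.+ k) ≈ z * d * (1# - z ^ l) + z * q * e * (z ^ l * (1# - (z * q) ^ k))
      stepSum-closed zero zero = lem z d (z * q * e)
        where
        lem = solve 3 (λ z d s →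
          con (+ 0) :=
          z :* d :* (con (+ 1) :- con (+ 1)) :+ s :* (con (+ 1) :* (con (+ 1) :- con (+ 1)))) refl
      stepSum-closed zero (suc k) = begin
        stepSum 0 (suc k)
          ≈⟨ stepSum-zero-suc k ⟩
        z * q + z * q * stepSum 0 k
          ≈⟨ +-congˡ (*-congˡ (trans (stepSum-closed zero k) (lem z d (z * q * e) _))) ⟩
        z * q + z * q * (z * q * e * (1# - (z * q) ^ k))
          ≈⟨ geometric-step (z * q) e _ (proj₂ (proj₂ 1-zq-unit)) ⟩
        z * q * e * (1# - (z * q) ^ suc k)
          ≈⟨ lem z d (z * q * e) _ ⟨
        z * d * (1# - 1#) + z * q * e * (1# * (1# - (z * q) ^ suc k)) ∎
        where
        lem = solve 4 (λ z d s v →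
          z :* d :* (con (+ 1) :- con (+ 1)) :+ s :* (con (+ 1) :* (con (+ 1) :- v)) :=
          s :* (con (+ 1) :- v)) refl
      stepSum-closed (suc l) k = begin
        stepSum (suc l) (suc l ℕ.+ k)
          ≈⟨ stepSum-suc l (l ℕ.+ k) ⟩
        z + z * stepSum l (l ℕ.+ k)
          ≈⟨ +-congˡ (*-congˡ (stepSum-closed l k)) ⟩
        z + z * (z * d * (1# - z ^ l) + z * q * e * (z ^ l * (1# - (z * q) ^ k)))
          ≈⟨ lem z _ (z * q * e) (z ^ l) _ ⟩
        z + z * (z * d * (1# - z ^ l)) + z * q * e * (z ^ suc l * (1# - (z * q) ^ k))
          ≈⟨ +-congʳ (geometric-step z d _ (proj₂ (proj₂ 1-z-unit))) ⟩
        z * d * (1# - z ^ suc l) + z * q * e * (z ^ suc l * (1# - (z * q) ^ k)) ∎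
        where
        lem = solve 5 (λ z a s v w →
          z :+ z :* (a :+ s :* (v :* w)) :=
          z :+ z :* a :+ s :* (z :* v :* w)) refl

      -- The factors 1^l, z^l and (1/q)^l are kept explicit, so that with `w` the weight of a
      -- sequence and `l` its last letter each product is a term of a_n at 1, z or 1/q.
      stepSum-eval : ∀ (q-unit : Unit q) {l n} w → l ≤ n →
        w * (q * stepSum l (suc n)) ≈
        z * q * d * (w * 1# ^ l - w * z ^ l)
          + z * q ^ 2 * e
            * (w * z ^ l - z * q * (w * (1# / q [ q-unit ]) ^ l * (z * q) ^ n))
      stepSum-eval q-unit {l} {n} w l≤n with k , ≡.refl ← ℕ.m≤n⇒∃[o]m+o≡n l≤n = begin
        w * (q * stepSum l (suc (l ℕ.+ k)))
          -- The new letter may reach n + 1, so `suc k` letters exceed l. The extra factor zq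
          -- becomes the ypq in front of f(xypq, 1/q).
          ≡⟨ cong (λ n → w * (q * stepSum l n)) (≡.sym (ℕ.+-suc l k)) ⟩
        w * (q * stepSum l (l ℕ.+ suc k))
          ≈⟨ *-congˡ (*-congˡ (stepSum-closed l (suc k))) ⟩
        w * (q * (z * d * (1# - z ^ l) + z * q * e * (z ^ l * (1# - z * q * (z * q) ^ k))))
          ≈⟨ lem w q z d e (z ^ l) ((z * q) ^ k) ⟩
        z * q * d * (w * 1# - w * z ^ l)
          + z * (q * (q * 1#)) * e * (w * z ^ l - z * q * (w * (z ^ l * (z * q) ^ k)))
          ≈⟨ +-cong
               (*-congˡ (+-congʳ (*-congˡ (sym (one-^ l)))))
               (*-congˡ (+-congˡ (-‿cong (*-congˡ
                 (trans (*-congˡ (z^l*[zq]^k q-unit l k)) (sym (*-assoc _ _ _))))))) ⟩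
        z * q * d * (w * 1# ^ l - w * z ^ l)
          + z * q ^ 2 * e
            * (w * z ^ l - z * q * (w * (1# / q [ q-unit ]) ^ l * (z * q) ^ (l ℕ.+ k))) ∎
        where
        lem = solve 7 (λ w q z d e s t →
          w :* (q :* (z :* d :* (con (+ 1) :- s) :+ z :* q :* e :* (s :* (con (+ 1) :- z :* q :* t)))) :=
          z :* q :* d :* (w :* con (+ 1) :- w :* s)
            :+ z :* (q :* (q :* con (+ 1))) :* e :* (w :* s :- z :* q :* (w :* (s :* t)))) refl

  -- The recurrence for a_n(y).

  sumOver-linear : ∀ (c₁ c₂ s t : Carrier) (g₁ g₂ g₃ : A → Carrier) xs →
    sumOver (λ x → c₁ * (g₁ x - g₂ x) + c₂ * (g₂ x - s * (g₃ x * t))) xs ≈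
    c₁ * (sumOver g₁ xs - sumOver g₂ xs) + c₂ * (sumOver g₂ xs - s * (sumOver g₃ xs * t))
  sumOver-linear c₁ c₂ s t g₁ g₂ g₃ [] = lem c₁ c₂ s t
    where
    lem = solve 4 (λ c₁ c₂ s t →
      con (+ 0) :=
      c₁ :* (con (+ 0) :- con (+ 0)) :+ c₂ :* (con (+ 0) :- s :* (con (+ 0) :* t))) refl
  sumOver-linear c₁ c₂ s t g₁ g₂ g₃ (x ∷ xs) =
    trans (+-congˡ (sumOver-linear c₁ c₂ s t g₁ g₂ g₃ xs)) (lem c₁ c₂ s t _ _ _ _ _ _)
    where
    lem = solve 10 (λ c₁ c₂ s t a b c a′ b′ c′ →
      c₁ :* (a :- b) :+ c₂ :* (b :- s :* (c :* t)) :+ (c₁ :* (a′ :- b′) :+ c₂ :* (b′ :- s :* (c′ :* t))) :=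
      c₁ :* ((a :+ a′) :- (b :+ b′)) :+ c₂ :* ((b :+ b′) :- s :* ((c :+ c′) :* t))) refl

  module _ (p q : Carrier) where

    weight : ∀ {m} → Vec ℕ (suc m) → Carrier
    weight ρ = p ^ area ρ * q ^ sper ρ

    -- Each `a[1+ m ][ i ]` is by definition a `sumOver` of a filtered list, so the fibre lemma
    -- applies with `g = last`.
    a[1+]≈sumOver : ∀ m y →
      a[1+_] p q m y ≈ sumOver (λ ρ → weight ρ * y ^ last ρ) (inversionSequences (suc m))
    a[1+]≈sumOver m y =
      sumOver-fibres (suc m) weight last (y ^_) (inversionSequences (suc m)) (last-bounds m)

    -- `y` marks only the new last letter, so its power merges with that of `p` into (yp)^r; the old
    -- last letter enters only through the rise.
    weight-∷ʳ : ∀ {m} (ρ : Vec ℕ (suc m)) r y →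
      weight (ρ ∷ʳ r) * y ^ last (ρ ∷ʳ r) ≈ weight ρ * q * ((y * p) ^ r * q ^ (r ∸ last ρ))
    weight-∷ʳ ρ r y = begin
      weight (ρ ∷ʳ r) * y ^ last (ρ ∷ʳ r)
        ≈⟨ *-cong (*-cong (^-congʳ p (area-∷ʳ ρ r)) (^-congʳ q (sper-∷ʳ ρ r))) (^-congʳ y (last-∷ʳ r ρ)) ⟩
      p ^ (area ρ ℕ.+ r) * (q * q ^ (sper ρ ℕ.+ (r ∸ last ρ))) * y ^ r
        ≈⟨ *-congʳ (*-cong (^-homo-* p (area ρ) r) (*-congˡ (^-homo-* q (sper ρ) (r ∸ last ρ)))) ⟩
      p ^ area ρ * p ^ r * (q * (q ^ sper ρ * q ^ (r ∸ last ρ))) * y ^ r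
        ≈⟨ lem (p ^ area ρ) (p ^ r) q (q ^ sper ρ) _ (y ^ r) ⟩
      weight ρ * q * (y ^ r * p ^ r * q ^ (r ∸ last ρ))
        ≈⟨ *-congˡ (*-congʳ (^-distrib-* y p r)) ⟨
      weight ρ * q * ((y * p) ^ r * q ^ (r ∸ last ρ)) ∎
      where
      lem = solve 6 (λ a b q s t v →
        a :* b :* (q :* (s :* t)) :* v :=
        a :* s :* q :* (v :* b :* t)) refl

    a-recurrence : ∀ m y
      (q-unit : Unit q) (1-yp-unit : Unit (1# - y * p)) (1-ypq-unit : Unit (1# - y * p * q)) →
      a[1+_] p q (suc m) y ≈
        (y * p * q) / (1# - y * p) [ 1-yp-unit ] * (a[1+_] p q m 1# - a[1+_] p q m (y * p))
        + (y * p * q ^ 2) / (1# - y * p * q) [ 1-ypq-unit ]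
          * (a[1+_] p q m (y * p)
             - y * p * q * (a[1+_] p q m (1# / q [ q-unit ]) * (y * p * q) ^ suc m))
    a-recurrence m y q-unit 1-yp-unit 1-ypq-unit = begin
      a[1+_] p q (suc m) y
        ≈⟨ a[1+]≈sumOver (suc m) y ⟩
      sumOver (λ ρ → weight ρ * y ^ last ρ) (inversionSequences (suc (suc m)))
        ≈⟨ sumOver-cartesianProductWith _ _∷ʳ_ seqs (applyUpTo suc (suc (suc m))) ⟩
      sumOver (λ ρ → sumOver (λ r → weight (ρ ∷ʳ r) * y ^ last (ρ ∷ʳ r)) (applyUpTo suc (suc (suc m)))) seqs
        ≈⟨ sumOver-cong seqs (λ {ρ} ρ∈ → begin
             sumOver (λ r → weight (ρ ∷ʳ r) * y ^ last (ρ ∷ʳ r)) (applyUpTo suc (suc (suc m)))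
               ≈⟨ sumOver-applyUpTo-*ˡ (weight ρ * q) _ _ (λ r → weight-∷ʳ ρ r y) suc (suc (suc m)) ⟩
             weight ρ * q * stepSum (y * p) q (last ρ) (suc (suc m))
               ≈⟨ *-assoc _ _ _ ⟩
             weight ρ * (q * stepSum (y * p) q (last ρ) (suc (suc m)))
               -- `ρ∈`, supplied by `sumOver-cong`, gives `last ρ ≤ suc m`.
               ≈⟨ stepSum-eval (y * p) q 1-yp-unit 1-ypq-unit q-unit (weight ρ) (proj₂ (last-bounds m ρ∈)) ⟩
             _ ∎) ⟩
      sumOver (λ ρ → _) seqs
        -- The power (ypq)^n depends only on the length n = `suc m`, so it leaves the sum as a
        -- constant.
        ≈⟨ sumOver-linear _ _ _ _ (term 1#) (term (y * p)) (term (1# / q [ q-unit ])) seqs ⟩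
      _ ≈⟨ +-cong
             (*-congˡ (+-cong (fold 1#) (-‿cong (fold (y * p)))))
             (*-congˡ (+-cong (fold (y * p)) (-‿cong (*-congˡ (*-congʳ (fold (1# / q [ q-unit ]))))))) ⟩
      _ ∎
      where
      seqs = inversionSequences (suc m)

      term : Carrier → Vec ℕ (suc m) → Carrier
      term v ρ = weight ρ * v ^ last ρ

      fold : ∀ v → sumOver (term v) seqs ≈ a[1+_] p q m v
      fold v = sym (a[1+]≈sumOver m v)

    -- The only sequence is the letter 1, of area 1 and semiperimeter 2. This is the inhomogeneous
    -- term of the equation.
    a₁ : ∀ y → a[1+_] p q 0 y ≈ y * p * q ^ 2
    a₁ = lem p q
      where
      lem = solve 3 (λ p q y →
        (p :* con (+ 1) :* (q :* (q :* con (+ 1))) :+ con (+ 0)) :* (y :* con (+ 1)) :+ con (+ 0) :=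
        y :* p :* (q :* (q :* con (+ 1)))) refl

  -- Factorials and comparison of coefficients.

  n×/n! : (n!-unit : ∀ n → Unit ((n !) × 1#)) → ∀ n a →
    suc n × (a / ((suc n !) × 1#) [ n!-unit (suc n) ]) ≈ a / ((n !) × 1#) [ n!-unit n ]
  n×/n! n!-unit n a = begin
    suc n × (a * v)                        ≈⟨ ×-congʳ (suc n) (*-identityˡ _) ⟨
    suc n × (1# * (a * v))                 ≈⟨ ×-assoc-* (suc n) 1# (a * v) ⟨
    N * (a * v)                            ≈⟨ *-identityʳ _ ⟨
    -- `u` and `v` are inverses given separately; they are linked by inserting n! u = 1 and then
    -- removing (n + 1) n! v = 1.
    N * (a * v) * 1#                       ≈⟨ *-congˡ (proj₂ (proj₂ (n!-unit n))) ⟨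
    N * (a * v) * ((n !) × 1# * u)         ≈⟨ lem N a v ((n !) × 1#) u ⟩
    N * ((n !) × 1#) * v * (a * u)         ≈⟨ *-congʳ (*-congʳ (×1-homo-* (suc n) (n !))) ⟨
    ((suc n !) × 1#) * v * (a * u)         ≈⟨ *-congʳ (proj₂ (proj₂ (n!-unit (suc n)))) ⟩
    1# * (a * u)                           ≈⟨ *-identityˡ _ ⟩
    a * u ∎
    where
    N = suc n × 1#
    u = proj₁ (n!-unit n)
    v = proj₁ (n!-unit (suc n))

    lem = solve 5 (λ N a v w u → N :* (a :* v) :* (w :* u) := N :* w :* v :* (a :* u)) refl

theorem2p2 : ∀ {c ℓ} (R : CommutativeRing c ℓ) →
    let open CommutativeRing R
        open GeneratingFunction R
    in (n!-unit : ∀ n → Unit ((n !) × 1#)) (y p q : Carrier)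
       (q-unit : Unit q) (1-yp-unit : Unit (1# - y * p)) (1-ypq-unit : Unit (1# - y * p * q)) →
       let F = f p q n!-unit in
       ∂ₓ (F y) ≋
         const (y * p * q ^ 2)
         ⊕ ((y * p * q) / (1# - y * p) [ 1-yp-unit ]) · (F 1# ⊖ F (y * p))
         ⊕ ((y * p * q ^ 2) / (1# - y * p * q) [ 1-ypq-unit ])
             · (F (y * p) ⊖ (y * p * q) · (F (1# / q [ q-unit ]) ⟨x* y * p * q ⟩))
theorem2p2 R n!-unit y p q q-unit 1-yp-unit 1-ypq-unit = coeff
  where
  open CommutativeRing R hiding (zero)
  open GeneratingFunction R
  open IntegerCoefficients R using (solve; con; _:=_; _:+_; _:*_; _:-_)
  open SetoidReasoning setoid

  F = f p q n!-unit
  c₁ = (y * p * q) / (1# - y * p) [ 1-yp-unit ]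
  c₂ = (y * p * q ^ 2) / (1# - y * p * q) [ 1-ypq-unit ]

  lem₀ = solve 5 (λ b c₁ c₂ s t →
    b :=
    b :+ c₁ :* (con (+ 0) :- con (+ 0)) :+ c₂ :* (con (+ 0) :- s :* (con (+ 0) :* t))) refl

  -- `u` is the inverse of (m + 1)!, distributed over the recurrence; `t` is (ypq)^(m + 1), produced
  -- by substituting xypq for x.
  lem₁ = solve 8 (λ c₁ c₂ s t a b c u →
    (c₁ :* (a :- b) :+ c₂ :* (b :- s :* (c :* t))) :* u :=
    con (+ 0) :+ c₁ :* (a :* u :- b :* u) :+ c₂ :* (b :* u :- s :* (c :* u :* t))) refl

  -- Here `(0 !) × 1#` unfolds to `1# + 0#`, so its given inverse must still be identified with
  -- `1#`.
  1/0!≈1 : proj₁ (n!-unit 0) ≈ 1#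
  1/0!≈1 = trans (sym (*-identityʳ _)) (trans (*-congˡ (sym (+-identityʳ 1#))) (proj₁ (proj₂ (n!-unit 0))))

  coeff : ∂ₓ (F y) ≋ const (y * p * q ^ 2) ⊕ c₁ · (F 1# ⊖ F (y * p))
    ⊕ c₂ · (F (y * p) ⊖ (y * p * q) · (F (1# / q [ q-unit ]) ⟨x* y * p * q ⟩))
  -- Every `F v 0` is `0#`, so on the right only the constant series contributes.
  coeff zero = begin
    1 × F y 1                         ≈⟨ n×/n! R n!-unit 0 _ ⟩
    a[1+_] p q 0 y * proj₁ (n!-unit 0) ≈⟨ *-cong (a₁ R p q y) 1/0!≈1 ⟩
    y * p * q ^ 2 * 1#                ≈⟨ *-identityʳ _ ⟩
    y * p * q ^ 2                     ≈⟨ lem₀ _ c₁ c₂ (y * p * q) _ ⟩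
    _ ∎
  coeff (suc m) = begin
    suc (suc m) × F y (suc (suc m))
      ≈⟨ n×/n! R n!-unit (suc m) _ ⟩
    a[1+_] p q (suc m) y * proj₁ (n!-unit (suc m))
      ≈⟨ *-congʳ (a-recurrence R p q m y q-unit 1-yp-unit 1-ypq-unit) ⟩
    _ ≈⟨ lem₁ c₁ c₂ (y * p * q) ((y * p * q) ^ suc m) _ _ _ _ ⟩
    _ ∎
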